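{- The scheme $\sim((\alpha\vee\beta)\vee\gamma)\rightarrow_{d}\sim(\alpha\vee(\beta\vee\gamma))$ is not provable in the axiom system $\mathrm{C}$; that is, there are formulas $\alpha,\beta,\gamma$ such that $\sim((\alpha\vee\beta)\vee\gamma)\rightarrow_{d}\sim(\alpha\vee(\beta\vee\gamma))$ is not a theorem of $\mathrm{C}$.
   Context: Formulas are built from a countably infinite set of propositional variables using the unary connective $\sim$ (negation) and the binary connectives $\vee$ (disjunction), $\rightarrow_{d}$ (discussive implication), $\wedge_{d}$ (discussive conjunction), all treated as primitive. $\sim$ binds more tightly than the binary connectives. The axiom system $\mathrm{C}$ has as its sole rule modus ponens for $\rightarrow_{d}$ (from $\alpha$ and $\alpha\rightarrow_{d}\beta$ infer $\beta$), and as axioms all instances (for arbitrary formulas $\alpha,\beta,\gamma$) of the following schemes: C1: $\alpha\rightarrow_{d}(\beta\rightarrow_{d}\alpha)$. C2: $(\alpha\rightarrow_{d}(\beta\rightarrow_{d}\gamma))\rightarrow_{d}((\alpha\rightarrow_{d}\beta)\rightarrow_{d}(\alpha\rightarrow_{d}\gamma))$. C3: $(\alpha\wedge_{d}\beta)\rightarrow_{d}\alpha$. C4: $(\alpha\wedge_{d}\beta)\rightarrow_{d}\beta$. C5: $\alpha\rightarrow_{d}(\beta\rightarrow_{d}(\alpha\wedge_{d}\beta))$. C6: $\alpha\rightarrow_{d}(\alpha\vee\beta)$. C7: $\beta\rightarrow_{d}(\alpha\vee\beta)$. C8: $(\alpha\rightarrow_{d}\gamma)\rightarrow_{d}((\beta\rightarrow_{d}\gamma)\rightarrow_{d}((\alpha\vee\beta)\rightarrow_{d}\gamma))$.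 C9: $\alpha\vee(\alpha\rightarrow_{d}\beta)$. C10: $\sim(\sim\alpha\wedge_{d}(\sim\sim\alpha\wedge_{d}\sim(\alpha\vee\sim\alpha)))$. C11: $\sim(\sim\alpha\wedge_{d}(\sim\beta\wedge_{d}\sim(\alpha\vee\beta)))\rightarrow_{d}\sim(\sim\alpha\wedge_{d}(\sim\beta\wedge_{d}(\sim\gamma\wedge_{d}\sim(\alpha\vee(\beta\vee\gamma)))))$. C12: $\sim(\sim\alpha\wedge_{d}(\sim\beta\wedge_{d}(\sim\gamma\wedge_{d}\sim(\alpha\vee(\beta\vee\gamma)))))\rightarrow_{d}\sim(\sim\alpha\wedge_{d}(\sim\gamma\wedge_{d}(\sim\beta\wedge_{d}\sim(\alpha\vee(\gamma\vee\beta)))))$. C13: $\sim(\sim\alpha\wedge_{d}(\sim\beta\wedge_{d}(\sim\gamma\wedge_{d}\sim(\alpha\vee(\beta\vee\gamma)))))\rightarrow_{d}((\alpha\vee(\beta\vee\sim\gamma))\rightarrow_{d}(\alpha\vee\beta))$. C14: $\sim(\sim\alpha\wedge_{d}\sim\beta)\rightarrow_{d}(\alpha\vee\beta)$. C15: $(\alpha\vee(\beta\vee\sim\beta))\rightarrow_{d}\sim(\sim\alpha\wedge_{d}\sim(\beta\vee\sim\beta))$. A theorem of $\mathrm{C}$ is a formula derivable from these axioms by finitely many applications of modus ponens. A scheme is said to be unprovable in $\mathrm{C}$ if at least one of its instances is not a theorem of $\mathrm{C}$. -}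

module Defs where

open import Data.Nat using (ℕ)

infix 9 ∼_
infix 7 _∨_ _∧d_
infix 6 _→d_
infix 4 ⊢_

data Formula : Set where
  var  : ℕ → Formula
  ∼_   : Formula → Formula
  _∨_  : Formula → Formula → Formula
  _→d_ : Formula → Formula → Formula
  _∧d_ : Formula → Formula → Formula

data Axiom : Formula → Set where
  C1  : ∀ α β → Axiom (α →d (β →d α))
  C2  : ∀ α β γ → Axiom ((α →d (β →d γ)) →d ((α →d β) →d (α →d γ)))
  C3  : ∀ α β → Axiom ((α ∧d β) →d α)
  C4  : ∀ α β → Axiom ((α ∧d β) →d β)
  C5  : ∀ α β → Axiom (α →d (β →d (α ∧d β)))
  C6  : ∀ α β → Axiom (α →d (α ∨ β))
  C7  : ∀ α β → Axiom (β →d (α ∨ β))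
  C8  : ∀ α β γ → Axiom ((α →d γ) →d ((β →d γ) →d ((α ∨ β) →d γ)))
  C9  : ∀ α β → Axiom (α ∨ (α →d β))
  C10 : ∀ α → Axiom (∼ (∼ α ∧d (∼ ∼ α ∧d ∼ (α ∨ ∼ α))))
  C11 : ∀ α β γ → Axiom
          (∼ (∼ α ∧d (∼ β ∧d ∼ (α ∨ β)))
            →d ∼ (∼ α ∧d (∼ β ∧d (∼ γ ∧d ∼ (α ∨ (β ∨ γ))))))
  C12 : ∀ α β γ → Axiom
          (∼ (∼ α ∧d (∼ β ∧d (∼ γ ∧d ∼ (α ∨ (β ∨ γ)))))
            →d ∼ (∼ α ∧d (∼ γ ∧d (∼ β ∧d ∼ (α ∨ (γ ∨ β))))))
  C13 : ∀ α β γ → Axiom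
          (∼ (∼ α ∧d (∼ β ∧d (∼ γ ∧d ∼ (α ∨ (β ∨ γ)))))
            →d ((α ∨ (β ∨ ∼ γ)) →d (α ∨ β)))
  C14 : ∀ α β → Axiom (∼ (∼ α ∧d ∼ β) →d (α ∨ β))
  C15 : ∀ α β → Axiom ((α ∨ (β ∨ ∼ β)) →d ∼ (∼ α ∧d ∼ (β ∨ ∼ β)))

data ⊢_ : Formula → Set where
  axiom : ∀ {α} → Axiom α → ⊢ α
  mp    : ∀ {α β} → ⊢ α → ⊢ (α →d β) → ⊢ β

{-# OPTIONS --safe #-}

-- A three-valued matrix validates C but not the scheme.  The values 0F, 1F, 2F
-- are "false", "true and false" and "true", with 1F and 2F designated.  Negation
-- is paraconsistent, and →d, ∧d are classical on designation.  For ∨, the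
-- axioms leave the value of a disjunction of two designated values largely free
-- within {1F , 2F}, so it may depend, in a non-associative way, on the left
-- disjunct alone.
module Submission where

open import Defs
open import Data.Bool using (Bool; true; false; T; if_then_else_)
open import Data.Bool.Properties using (T?)
open import Data.Fin using (Fin)
open import Data.Fin.Patterns using (0F; 1F; 2F)
open import Data.Fin.Properties using (all?)
open import Data.Product using (∃-syntax; _,_)
open import Relation.Nullary using (¬_)
open import Relation.Nullary.Decidable using (True; toWitness)

Value : Set
Value = Fin 3

designated : Value → Bool
designated 0F = false
designated 1F = true
designated 2F = true

Designated : Value → Set
Designated a = T (designated a)

infix 9 ~_
infix 7 _⊔_ _⊓_
infix 6 _⇒_

~_ : Value → Value
~ 0F = 2F
~ 1F = 1F
~ 2F = 0F

-- With the other operations as given, C10 forces `1F ⊔ 1F` to be `2F`, and C11 then forces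
-- `1F ⊔ 2F` to be `2F`.
_⊔_ : Value → Value → Value
0F ⊔ b  = b
a  ⊔ 0F = a
1F ⊔ _  = 2F
2F ⊔ _  = 1F

_⇒_ : Value → Value → Value
a ⇒ b = if designated a then (if designated b then 2F else 0F) else 2F

-- Never `1F`, so `~_` is classical on it. As `~ a` is undesignated only at `2F`, the negated
-- conjunctions in C10 to C13 say that some entry is `2F`.
_⊓_ : Value → Value → Value
a ⊓ b = if designated a then (if designated b then 2F else 0F) else 0F

⟦_⟧ : Formula → Value
⟦ var _ ⟧  = 1F
⟦ ∼ α ⟧    = ~ ⟦ α ⟧
⟦ α ∨ β ⟧  = ⟦ α ⟧ ⊔ ⟦ β ⟧
⟦ α →d β ⟧ = ⟦ α ⟧ ⇒ ⟦ β ⟧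
⟦ α ∧d β ⟧ = ⟦ α ⟧ ⊓ ⟦ β ⟧

-- For a closed `f` the implicit argument evaluates to the unit type, so the truth table is checked
-- by computation.
valid₁ : (f : Value → Value) →
         {True (all? λ a → T? (designated (f a)))} →
         ∀ α → Designated (f ⟦ α ⟧)
valid₁ _ {w} α = toWitness w ⟦ α ⟧

valid₂ : (f : Value → Value → Value) →
         {True (all? λ a → all? λ b → T? (designated (f a b)))} →
         ∀ α β → Designated (f ⟦ α ⟧ ⟦ β ⟧)
valid₂ _ {w} α β = toWitness w ⟦ α ⟧ ⟦ β ⟧

valid₃ : (f : Value → Value → Value → Value) →
         {True (all? λ a → all? λ b → all? λ c → T? (designated (f a b c)))} →
         ∀ α β γ → Designated (f ⟦ α ⟧ ⟦ β ⟧ ⟦ γ ⟧)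
valid₃ _ {w} α β γ = toWitness w ⟦ α ⟧ ⟦ β ⟧ ⟦ γ ⟧

axiom-designated : ∀ {α} → Axiom α → Designated ⟦ α ⟧
axiom-designated (C1 α β)    = valid₂ (λ a b → a ⇒ (b ⇒ a)) α β
axiom-designated (C2 α β γ)  =
  valid₃ (λ a b c → (a ⇒ (b ⇒ c)) ⇒ ((a ⇒ b) ⇒ (a ⇒ c))) α β γ
axiom-designated (C3 α β)    = valid₂ (λ a b → (a ⊓ b) ⇒ a) α β
axiom-designated (C4 α β)    = valid₂ (λ a b → (a ⊓ b) ⇒ b) α β
axiom-designated (C5 α β)    = valid₂ (λ a b → a ⇒ (b ⇒ (a ⊓ b))) α β
axiom-designated (C6 α β)    = valid₂ (λ a b → a ⇒ (a ⊔ b)) α β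
axiom-designated (C7 α β)    = valid₂ (λ a b → b ⇒ (a ⊔ b)) α β
axiom-designated (C8 α β γ)  =
  valid₃ (λ a b c → (a ⇒ c) ⇒ ((b ⇒ c) ⇒ ((a ⊔ b) ⇒ c))) α β γ
axiom-designated (C9 α β)    = valid₂ (λ a b → a ⊔ (a ⇒ b)) α β
axiom-designated (C10 α)     = valid₁ (λ a → ~ (~ a ⊓ (~ ~ a ⊓ ~ (a ⊔ ~ a)))) α
axiom-designated (C11 α β γ) =
  valid₃ (λ a b c → ~ (~ a ⊓ (~ b ⊓ ~ (a ⊔ b)))
                  ⇒ ~ (~ a ⊓ (~ b ⊓ (~ c ⊓ ~ (a ⊔ (b ⊔ c)))))) α β γ
axiom-designated (C12 α β γ) =
  valid₃ (λ a b c → ~ (~ a ⊓ (~ b ⊓ (~ c ⊓ ~ (a ⊔ (b ⊔ c)))))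
                  ⇒ ~ (~ a ⊓ (~ c ⊓ (~ b ⊓ ~ (a ⊔ (c ⊔ b)))))) α β γ
axiom-designated (C13 α β γ) =
  valid₃ (λ a b c → ~ (~ a ⊓ (~ b ⊓ (~ c ⊓ ~ (a ⊔ (b ⊔ c)))))
                  ⇒ ((a ⊔ (b ⊔ ~ c)) ⇒ (a ⊔ b))) α β γ
axiom-designated (C14 α β)   = valid₂ (λ a b → ~ (~ a ⊓ ~ b) ⇒ (a ⊔ b)) α β
axiom-designated (C15 α β)   =
  valid₂ (λ a b → (a ⊔ (b ⊔ ~ b)) ⇒ ~ (~ a ⊓ ~ (b ⊔ ~ b))) α β

modus-ponens : ∀ a b → Designated a → Designated (a ⇒ b) → Designated b
modus-ponens a b a-des a⇒b-des with designated a | designated b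
-- In every other case one hypothesis reduces to the empty `T false`.
... | true | true = _

soundness : ∀ {α} → ⊢ α → Designated ⟦ α ⟧
soundness (axiom ax)         = axiom-designated ax
soundness (mp {α} {β} ⊢α ⊢αβ) =
  modus-ponens ⟦ α ⟧ ⟦ β ⟧ (soundness ⊢α) (soundness ⊢αβ)

proposition2p7 : ∃[ α ] ∃[ β ] ∃[ γ ] ¬ (⊢ (∼ ((α ∨ β) ∨ γ) →d ∼ (α ∨ (β ∨ γ))))
-- All variables are `1F`: the premise is `~ (2F ⊔ 1F)`, that is `1F`, and the conclusion is
-- `~ (1F ⊔ 2F)`, that is `0F`. Hence the implication is `0F`, and `soundness` already lands in the
-- empty type.
proposition2p7 = var 0 , var 1 , var 2 , soundness
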